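{- For every constant $C>0$ there exists a constant $c>0$ such that for infinitely many positive integers $n$ there is an $n$-vertex directed unweighted graph $G=(V,E)$ with the following property: for every shortcut set $H$ of $G$ with $|H|\le Cn$, the graph $G\cup H$ has diameter at least $c\, n^{1/4}$.
   Context: For a directed graph $G=(V,E)$, a shortcut set is a set $H$ of ordered pairs $(u,v)$ of distinct vertices such that $v$ is reachable from $u$ in $G$ (i.e. $H$ is a set of edges of the transitive closure of $G$). $G\cup H$ denotes the graph $(V,E\cup H)$. The diameter of a directed graph is $\max \mathrm{dist}(u,v)$ over all ordered pairs $(u,v)$ with $v$ reachable from $u$, where $\mathrm{dist}$ is the unweighted shortest-path distance. -}

module Defs where

open import Data.Nat using (ℕ; zero; suc; _≤_)
open import Data.Fin using (Fin)
open import Data.Product using (_×_; _,_; ∃; ∃-syntax; Σ-syntax)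
open import Data.List using (List; _++_)
open import Data.List.Membership.Propositional using (_∈_)
open import Relation.Binary.PropositionalEquality using (_≡_)
open import Relation.Nullary using (¬_)

-- A directed unweighted graph on the vertex set Fin n, given by its
-- (finite) list of directed edges (u , v) meaning u → v.
Graph : ℕ → Set
Graph n = List (Fin n × Fin n)

data Walk {n : ℕ} (E : Graph n) : Fin n → Fin n → ℕ → Set where
  here : ∀ {u} → Walk E u u zero
  step : ∀ {u w v k} → (u , w) ∈ E → Walk E w v k → Walk E u v (suc k)

Reachable : {n : ℕ} → Graph n → Fin n → Fin n → Set
Reachable E u v = ∃[ k ] Walk E u v k

DistAtLeast : {n : ℕ} → Graph n → Fin n → Fin n → ℕ → Set
DistAtLeast E u v D = Reachable E u v × (∀ k → Walk E u v k → D ≤ k)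

-- diam(E) ≥ D, where diam = max dist(u,v) over ordered pairs with v
-- reachable from u: some reachable pair has distance at least D.
DiameterAtLeast : {n : ℕ} → Graph n → ℕ → Set
DiameterAtLeast E D = ∃[ u ] ∃[ v ] DistAtLeast E u v D

IsShortcutSet : {n : ℕ} → Graph n → List (Fin n × Fin n) → Set
IsShortcutSet {n} E H = ∀ {u v : Fin n} → (u , v) ∈ H → (¬ u ≡ v) × Reachable E u v

{-# OPTIONS --safe #-}
module Submission where

open import Defs
open import Data.Nat using (ℕ; _≤_; _*_; _^_; _+_; suc)
open import Data.Product using (_×_; _,_; ∃-syntax; Σ-syntax)
open import Data.Fin using (Fin)
open import Data.List using (List; length; _++_)
open import Data.List.Relation.Unary.Unique.Propositional using (Unique)

import Data.Fin.Properties as Fin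
import Data.List.Relation.Unary.Any as Any
open import Data.Fin using (toℕ; fromℕ<; combine; remQuot)
open import Data.Empty using (⊥-elim)
open import Data.List using ([]; _∷_; map; filter; cartesianProduct; allFin)
open import Data.List.Membership.Propositional using (_∈_)
open import Data.List.Membership.Propositional.Properties using (∈-filter⁺; ∈-filter⁻; ∈-cartesianProduct⁺; ∈-allFin; ∈-++⁺ˡ; ∈-++⁻)
open import Data.List.Relation.Unary.Any using (here; there)
open import Data.Nat using (zero; _<_; _∸_; _/_; _%_; z≤n; s≤s; s≤s⁻¹; NonZero)
open import Data.Nat.DivMod using (m≡m%n+[m/n]*n; m%n<n; m<n⇒m%n≡m; m<n⇒m/n≡0; m*n/n≡m; [m+kn]%n≡m%n; /-monoˡ-≤; +-distrib-/-∣ʳ; m<n*o⇒m/o<n)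
open import Data.Nat.Divisibility using (n∣m*n)
open import Data.Nat.ListAction using (sum)
open import Data.Nat.Properties
open import Data.Nat.Tactic.RingSolver using (solve-∀)
open import Data.Product using (proj₁; proj₂; uncurry)
open import Data.Sum as Sum using (_⊎_; inj₁; inj₂; [_,_]′)
open import Function using (_∘_)
open import Relation.Binary.PropositionalEquality using (_≡_; _≢_; refl; sym; trans; cong; cong₂; subst; subst₂)
open import Relation.Nullary.Decidable using (decidable-stable; map′)
open import Relation.Nullary using (¬_; Dec; yes; no; ¬?; _×-dec_)

-- Take L + 1 layers of plane grids. An edge from layer l to layer l + 1 adds (a, 2 sₗ a + L a²) to the
-- grid position, for some a ≤ K, where the sₗ run through the bit reversal sequence below L. For each
-- direction t < KL exactly one a minimises the linear functional y - (2t + 1 + L) x on the edges of a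
-- layer, so the path which follows the minimisers from layer 0 to layer L is the only path between its
-- endpoints. By the equidistribution of bit reversal, two directions whose minimisers agree on x
-- consecutive layers differ by O(L / x). Hence a shortcut spanning x layers lies on O(L / x) critical
-- paths and saves O(L) steps on all of them together, whereas Ω(K n) critical paths would each have
-- to be shortened by L / 2. There are Θ(L³) positions per layer for fixed K, so n = Θ(L⁴); K is chosen
-- large compared with C.

-- Sums and indicator functions

∑ : ℕ → (ℕ → ℕ) → ℕ
∑ zero    f = 0
∑ (suc n) f = ∑ n f + f n

+-swapʳ : ∀ a b c → a + b + c ≡ a + c + b
+-swapʳ = solve-∀

∑-mono : ∀ n {f g} → (∀ i → i < n → f i ≤ g i) → ∑ n f ≤ ∑ n g
∑-mono zero    f≤g = z≤n
∑-mono (suc n) f≤g = +-mono-≤ (∑-mono n λ i i<n → f≤g i (m<n⇒m<1+n i<n)) (f≤g n ≤-refl)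

∑-const : ∀ n c → ∑ n (λ _ → c) ≡ n * c
∑-const zero    c = refl
∑-const (suc n) c = trans (cong (_+ c) (∑-const n c)) (+-comm (n * c) c)

∑-*ʳ : ∀ n f c → ∑ n (λ i → f i * c) ≡ ∑ n f * c
∑-*ʳ zero    f c = refl
∑-*ʳ (suc n) f c = trans (cong (_+ f n * c) (∑-*ʳ n f c)) (sym (*-distribʳ-+ c (∑ n f) (f n)))

∑-+ : ∀ n f g → ∑ n (λ i → f i + g i) ≡ ∑ n f + ∑ n g
∑-+ zero    f g = refl
∑-+ (suc n) f g = trans (cong (_+ (f n + g n)) (∑-+ n f g)) (rearrange (∑ n f) (∑ n g) (f n) (g n))
  where
  rearrange : ∀ a b c d → a + b + (c + d) ≡ a + c + (b + d)
  rearrange = solve-∀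

∑-sum-map : ∀ {A : Set} n (f : ℕ → A → ℕ) xs →
  ∑ n (λ i → sum (map (f i) xs)) ≡ sum (map (λ x → ∑ n (λ i → f i x)) xs)
∑-sum-map n f []       = trans (∑-const n 0) (*-zeroʳ n)
∑-sum-map n f (x ∷ xs) = trans (∑-+ n (λ i → f i x) (λ i → sum (map (f i) xs)))
  (cong (∑ n (λ i → f i x) +_) (∑-sum-map n f xs))

module _ {A : Set} {f g : A → ℕ} where

  sum-map-mono : (∀ x → f x ≤ g x) → ∀ xs → sum (map f xs) ≤ sum (map g xs)
  sum-map-mono f≤g []       = z≤n
  sum-map-mono f≤g (x ∷ xs) = +-mono-≤ (f≤g x) (sum-map-mono f≤g xs)

  sum-map-gain : (∀ x → f x ≤ g x) → ∀ {x d xs} → x ∈ xs → f x + d ≤ g x →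
    sum (map f xs) + d ≤ sum (map g xs)
  sum-map-gain f≤g {d = d} {y ∷ xs} (here refl) gain = begin
    f y + sum (map f xs) + d    ≡⟨ +-assoc (f y) _ d ⟩
    f y + (sum (map f xs) + d)  ≡⟨ cong (f y +_) (+-comm (sum (map f xs)) d) ⟩
    f y + (d + sum (map f xs))  ≡⟨ +-assoc (f y) d _ ⟨
    f y + d + sum (map f xs)    ≤⟨ +-mono-≤ gain (sum-map-mono f≤g xs) ⟩
    g y + sum (map g xs)        ∎
    where open ≤-Reasoning
  sum-map-gain f≤g {d = d} {y ∷ xs} (there x∈xs) gain = begin
    f y + sum (map f xs) + d    ≡⟨ +-assoc (f y) _ d ⟩
    f y + (sum (map f xs) + d)  ≤⟨ +-mono-≤ (f≤g y) (sum-map-gain f≤g x∈xs gain) ⟩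
    g y + sum (map g xs)        ∎
    where open ≤-Reasoning

sum-map-≤-length : ∀ {A : Set} {f : A → ℕ} {c} → (∀ x → f x ≤ c) → ∀ xs → sum (map f xs) ≤ length xs * c
sum-map-≤-length f≤c []       = z≤n
sum-map-≤-length f≤c (x ∷ xs) = +-mono-≤ (f≤c x) (sum-map-≤-length f≤c xs)

𝟙 : ∀ {P : Set} → Dec P → ℕ
𝟙 (yes _) = 1
𝟙 (no _)  = 0

𝟙-mono : ∀ {P Q : Set} (P? : Dec P) (Q? : Dec Q) → (P → Q) → 𝟙 P? ≤ 𝟙 Q?
𝟙-mono (no _)  _       _   = z≤n
𝟙-mono (yes _) (yes _) _   = ≤-refl
𝟙-mono (yes p) (no ¬q) p⇒q = ⊥-elim (¬q (p⇒q p))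

𝟙-true : ∀ {P : Set} (P? : Dec P) → P → 𝟙 P? ≡ 1
𝟙-true (yes _) _ = refl
𝟙-true (no ¬p) p = ⊥-elim (¬p p)

𝟙-false : ∀ {P : Set} (P? : Dec P) → ¬ P → 𝟙 P? ≡ 0
𝟙-false (yes p) ¬p = ⊥-elim (¬p p)
𝟙-false (no _)  _  = refl

module _ {Q : ℕ → Set} (Q? : ∀ i → Dec (Q i)) where

  -- The counted indices all lie in the interval from `v - w` up to `n`, the latter excluded.
  ∑-𝟙-above : ∀ n {v w} → (∀ i → i < n → Q i → v ≤ i + w) → ∑ n (λ i → 𝟙 (Q? i)) ≤ n + w ∸ v
  ∑-𝟙-above zero    bound = z≤n
  ∑-𝟙-above (suc n) {v} {w} bound with ∑-𝟙-above n {v} {w} (λ i i<n → bound i (m<n⇒m<1+n i<n)) | Q? n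
  ... | ih | no _  = ≤-trans (≤-reflexive (+-identityʳ _)) (≤-trans ih (∸-monoˡ-≤ v (n≤1+n (n + w))))
  ... | ih | yes q = begin
    ∑ n (λ i → 𝟙 (Q? i)) + 1  ≤⟨ +-monoˡ-≤ 1 ih ⟩
    n + w ∸ v + 1             ≡⟨ +-comm (n + w ∸ v) 1 ⟩
    1 + (n + w ∸ v)           ≡⟨ +-∸-assoc 1 (bound n ≤-refl q) ⟨
    suc n + w ∸ v             ∎
    where open ≤-Reasoning

  -- The largest counted index confines the others: none lies `w` or more below it.
  ∑-𝟙-window : ∀ n {w} → (∀ i j → i ≤ j → Q i → Q j → j < i + w) → ∑ n (λ i → 𝟙 (Q? i)) ≤ w
  ∑-𝟙-window zero    close = z≤n
  ∑-𝟙-window (suc n) {w} close with Q? n in eq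
  ... | no _  = ≤-trans (≤-reflexive (+-identityʳ _)) (∑-𝟙-window n close)
  ... | yes q = begin
    ∑ n (λ i → 𝟙 (Q? i)) + 1             ≡⟨ cong (λ d → ∑ n (λ i → 𝟙 (Q? i)) + 𝟙 d) eq ⟨
    ∑ (suc n) (λ i → 𝟙 (Q? i))           ≤⟨ ∑-𝟙-above (suc n) (λ i i≤n qi → close i n (s≤s⁻¹ i≤n) qi q) ⟩
    suc n + w ∸ suc n                    ≡⟨ m+n∸m≡n (suc n) w ⟩
    w                                    ∎
    where open ≤-Reasoning

∑-𝟙-unique : ∀ {Q : ℕ → Set} {R : Set} (Q? : ∀ i → Dec (Q i)) (R? : Dec R) → (∀ i → Q i → R) →
  (∀ i j → Q i → Q j → i ≡ j) → ∀ n → ∑ n (λ i → 𝟙 (Q? i)) ≤ 𝟙 R?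
∑-𝟙-unique Q? (yes _) _   unique n = ∑-𝟙-window Q? n λ i j _ qi qj →
  ≤-reflexive (trans (cong suc (unique j i qj qi)) (+-comm 1 i))
∑-𝟙-unique Q? (no ¬r) Q⇒R _      n = ≤-trans
  (∑-mono n λ i _ → ≤-reflexive (𝟙-false (Q? i) (¬r ∘ Q⇒R i)))
  (≤-reflexive (trans (∑-const n 0) (*-zeroʳ n)))

-- Sums over the indices from `i` to `j - 1` are differences of prefix sums, with the subtractions
-- moved across. A pointwise smaller function whose sum is not smaller must agree in every term.
∑-pointwise : ∀ {f g} → (∀ i → f i ≤ g i) → ∀ {i j l} → i ≤ l → l < j →
  ∑ j g + ∑ i f ≤ ∑ j f + ∑ i g → g l ≤ f l
∑-pointwise {f} {g} f≤g {i} {suc j} {l} i≤l (s≤s l≤j) total with m≤n⇒m<n∨m≡n l≤j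
... | inj₁ l<j = ∑-pointwise f≤g i≤l l<j (+-cancelʳ-≤ (g j) _ _ (begin
    ∑ j g + ∑ i f + g j  ≡⟨ +-swapʳ (∑ j g) _ _ ⟩
    ∑ j g + g j + ∑ i f  ≤⟨ total ⟩
    ∑ j f + f j + ∑ i g  ≡⟨ +-swapʳ (∑ j f) _ _ ⟩
    ∑ j f + ∑ i g + f j  ≤⟨ +-monoʳ-≤ (∑ j f + ∑ i g) (f≤g j) ⟩
    ∑ j f + ∑ i g + g j  ∎))
  where
  open ≤-Reasoning
... | inj₂ refl = +-cancelˡ-≤ (∑ l f + ∑ i g) _ _ (begin
    ∑ l f + ∑ i g + g l    ≤⟨ +-monoˡ-≤ (g l) (increments l i≤l) ⟩
    ∑ l g + ∑ i f + g l    ≡⟨ +-swapʳ (∑ l g) _ _ ⟩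
    ∑ l g + g l + ∑ i f    ≤⟨ total ⟩
    ∑ l f + f l + ∑ i g    ≡⟨ +-swapʳ (∑ l f) _ _ ⟩
    ∑ l f + ∑ i g + f l    ∎)
  where
  open ≤-Reasoning
  increments : ∀ n → i ≤ n → ∑ n f + ∑ i g ≤ ∑ n g + ∑ i f
  increments n i≤n with m≤n⇒m<n∨m≡n i≤n
  increments (suc n) _ | inj₁ (s≤s i≤n) = begin
    ∑ n f + f n + ∑ i g  ≡⟨ +-swapʳ (∑ n f) _ _ ⟩
    ∑ n f + ∑ i g + f n  ≤⟨ +-mono-≤ (increments n i≤n) (f≤g n) ⟩
    ∑ n g + ∑ i f + g n  ≡⟨ +-swapʳ (∑ n g) _ _ ⟩
    ∑ n g + g n + ∑ i f  ∎
  ... | inj₂ refl = ≤-reflexive (+-comm (∑ i f) (∑ i g))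

-- Bit reversal

-- offset k l is the reversal of the complements of the k lowest bits of l, and
-- choice k l t = 1 + ⌊(t - offset k l) / 2^k⌋ (see choice-above and choice-below).
offset : ℕ → ℕ → ℕ
offset zero    l = 0
offset (suc k) l = offset k (l / 2) + (1 ∸ l % 2) * 2 ^ k

choice : ℕ → ℕ → ℕ → ℕ
choice zero    l t = suc t
choice (suc k) l t = (choice k (l / 2) t + l % 2) / 2

bit-complement : ∀ l → l % 2 + (1 ∸ l % 2) ≡ 1
bit-complement l = m+[n∸m]≡n (s≤s⁻¹ (m%n<n l 2))

offset≤ : ∀ k l → offset k l ≤ 2 ^ k
offset≤ zero    l = z≤n
offset≤ (suc k) l = +-mono-≤ (offset≤ k (l / 2)) (*-monoˡ-≤ (2 ^ k) (m∸n≤m 1 (l % 2)))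

-- Halving `c + b` with rounding down loses at most 1, and `1 = b + b'`; so `c ≤ b' + c' * 2`, where
-- `b'` is the bit that `offset` gains at this level.
choice-above : ∀ k l t → t < 2 ^ k * choice k l t + offset k l
choice-above zero    l t = ≤-reflexive (sym (trans (+-identityʳ _) (+-identityʳ _)))
choice-above (suc k) l t = begin-strict
  t                                       <⟨ choice-above k (l / 2) t ⟩
  2 ^ k * c + offset k (l / 2)            ≤⟨ +-monoˡ-≤ _ (*-monoʳ-≤ (2 ^ k) c≤) ⟩
  2 ^ k * (b' + c' * 2) + offset k (l / 2) ≡⟨ rearrange (2 ^ k) b' c' (offset k (l / 2)) ⟩
  2 ^ suc k * c' + offset (suc k) l        ∎
  where
  open ≤-Reasoning
  c b b' c' : ℕ
  c  = choice k (l / 2) t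
  b  = l % 2
  b' = 1 ∸ b
  c' = (c + b) / 2
  rearrange : ∀ L x y s → L * (x + y * 2) + s ≡ 2 * L * y + (s + x * L)
  rearrange = solve-∀
  c≤ : c ≤ b' + c' * 2
  c≤ = +-cancelʳ-≤ b c _ (begin
    c + b                    ≡⟨ m≡m%n+[m/n]*n (c + b) 2 ⟩
    (c + b) % 2 + c' * 2     ≤⟨ +-monoˡ-≤ (c' * 2) (s≤s⁻¹ (m%n<n (c + b) 2)) ⟩
    1 + c' * 2               ≡⟨ cong (_+ c' * 2) (bit-complement l) ⟨
    b + b' + c' * 2          ≡⟨ move b b' (c' * 2) ⟩
    b' + c' * 2 + b          ∎)
    where
    move : ∀ x y z → x + y + z ≡ y + z + x
    move = solve-∀

choice-below : ∀ k l t → 2 ^ k * choice k l t + offset k l ≤ t + 2 ^ k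
choice-below zero    l t = ≤-reflexive (base t)
  where
  base : ∀ t → 1 * (1 + t) + 0 ≡ t + 1
  base = solve-∀
choice-below (suc k) l t = begin
  2 ^ suc k * c' + offset (suc k) l         ≡⟨ rearrange (2 ^ k) b' c' (offset k (l / 2)) ⟩
  2 ^ k * (c' * 2 + b') + offset k (l / 2)  ≤⟨ +-monoˡ-≤ _ (*-monoʳ-≤ (2 ^ k) ≤c) ⟩
  2 ^ k * (c + 1) + offset k (l / 2)        ≡⟨ rearrange′ (2 ^ k) c (offset k (l / 2)) ⟩
  2 ^ k * c + offset k (l / 2) + 2 ^ k      ≤⟨ +-monoˡ-≤ (2 ^ k) (choice-below k (l / 2) t) ⟩
  t + 2 ^ k + 2 ^ k                         ≡⟨ rearrange″ t (2 ^ k) ⟩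
  t + 2 ^ suc k                             ∎
  where
  open ≤-Reasoning
  c b b' c' : ℕ
  c  = choice k (l / 2) t
  b  = l % 2
  b' = 1 ∸ b
  c' = (c + b) / 2
  rearrange : ∀ L x y s → 2 * L * y + (s + x * L) ≡ L * (y * 2 + x) + s
  rearrange = solve-∀
  rearrange′ : ∀ L c s → L * (c + 1) + s ≡ L * c + s + L
  rearrange′ = solve-∀
  rearrange″ : ∀ t L → t + L + L ≡ t + 2 * L
  rearrange″ = solve-∀
  ≤c : c' * 2 + b' ≤ c + 1
  ≤c = begin
    c' * 2 + b'                   ≤⟨ +-monoˡ-≤ b' (m≤n+m (c' * 2) ((c + b) % 2)) ⟩
    (c + b) % 2 + c' * 2 + b'     ≡⟨ cong (_+ b') (m≡m%n+[m/n]*n (c + b) 2) ⟨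
    c + b + b'                    ≡⟨ +-assoc c b b' ⟩
    c + (b + b')                  ≡⟨ cong (c +_) (bit-complement l) ⟩
    c + 1                         ∎

choice-mono : ∀ k l {t t′} → t ≤ t′ → choice k l t ≤ choice k l t′
choice-mono zero    l t≤t′ = s≤s t≤t′
choice-mono (suc k) l t≤t′ = /-monoˡ-≤ 2 (+-monoˡ-≤ (l % 2) (choice-mono k (l / 2) t≤t′))

-- By the two bounds above, `2 ^ k * choice k l t + offset k l` lies above `t` and is at most
-- `t + 2 ^ k`. The intervals for `t` and `t + 2 ^ k` are disjoint.
choice-period : ∀ k l t → choice k l t < choice k l (t + 2 ^ k)
choice-period k l t = *-cancelˡ-< (2 ^ k) _ _ (+-cancelʳ-< (offset k l + 2 ^ k) _ _ (begin-strict
  2 ^ k * choice k l t + (offset k l + 2 ^ k)            ≡⟨ +-assoc (2 ^ k * choice k l t) _ _ ⟨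
  2 ^ k * choice k l t + offset k l + 2 ^ k              ≤⟨ +-monoˡ-≤ (2 ^ k) (choice-below k l t) ⟩
  t + 2 ^ k + 2 ^ k                                      <⟨ +-monoˡ-< (2 ^ k) (choice-above k l (t + 2 ^ k)) ⟩
  2 ^ k * choice k l (t + 2 ^ k) + offset k l + 2 ^ k    ≡⟨ +-assoc (2 ^ k * choice k l (t + 2 ^ k)) _ _ ⟩
  2 ^ k * choice k l (t + 2 ^ k) + (offset k l + 2 ^ k)  ∎))
  where open ≤-Reasoning

-- The bit `b` makes `c + b` odd, so the rounded half jumps right after it.
split-choice : ∀ {c c′} → c < c′ → ∃[ b ] (b < 2 × (c + b) / 2 < (c′ + b) / 2)
split-choice {c} {c′} c<c′ = b , m%n<n (suc c) 2 , (begin-strict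
  (c + b) / 2   <⟨ m<n*o⇒m/o<n {n = q} {o = 2} lower ⟩
  q             ≡⟨ m*n/n≡m q 2 ⟨
  q * 2 / 2     ≤⟨ /-monoˡ-≤ 2 upper ⟩
  (c′ + b) / 2  ∎)
  where
  open ≤-Reasoning
  b r q : ℕ
  b = suc c % 2
  r = suc c / 2
  q = r + b
  total : suc (c + b) ≡ q * 2
  total = trans (cong (_+ b) (m≡m%n+[m/n]*n (suc c) 2)) (rearrange b r)
    where
    rearrange : ∀ b r → b + r * 2 + b ≡ (r + b) * 2
    rearrange = solve-∀
  lower : c + b < q * 2
  lower = ≤-reflexive total
  upper : q * 2 ≤ c′ + b
  upper = ≤-trans (≤-reflexive (sym total)) (+-monoˡ-≤ b c<c′)

-- The hypothesis for j is applied to the halved indices; the last bit of l is then free to separate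
-- the halved choices as well.
choice-separates : ∀ j d i t → ∃[ l ] (i ≤ l × l + 2 ≤ i + 2 ^ suc j ×
  choice (j + d) l t < choice (j + d) l (t + 2 ^ d))
choice-separates zero    d i t = i , ≤-refl , ≤-refl , choice-period d i t
choice-separates (suc j) d i t
  with l , i′≤l , l≤ , c<c′ ← choice-separates j d (suc i / 2) t
  with b , b<2 , split ← split-choice c<c′
  = b + l * 2 , lower , upper , subst₂ (λ h r → (choice (j + d) h t + r) / 2 < (choice (j + d) h (t + 2 ^ d) + r) / 2)
      (sym half) (sym parity) split
  where
  open ≤-Reasoning
  -- Half of `i` rounded up, so that doubling does not fall below `i`. The slack 2 in `l + 2`
  -- doubles to 4; the rounding and the bit `b` cost at most 1 each, which leaves 2 again.
  i′ = suc i / 2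
  parity : (b + l * 2) % 2 ≡ b
  parity = trans ([m+kn]%n≡m%n b l 2) (m<n⇒m%n≡m b<2)
  half : (b + l * 2) / 2 ≡ l
  half = trans (+-distrib-/-∣ʳ b (n∣m*n l)) (cong₂ _+_ (m<n⇒m/n≡0 b<2) (m*n/n≡m l 2))
  lower : i ≤ b + l * 2
  lower = begin
    i           ≤⟨ s≤s⁻¹ (begin
      suc i                    ≡⟨ m≡m%n+[m/n]*n (suc i) 2 ⟩
      suc i % 2 + i′ * 2       ≤⟨ +-monoˡ-≤ (i′ * 2) (s≤s⁻¹ (m%n<n (suc i) 2)) ⟩
      suc (i′ * 2)             ∎) ⟩
    i′ * 2      ≤⟨ *-monoˡ-≤ 2 i′≤l ⟩
    l * 2       ≤⟨ m≤n+m (l * 2) b ⟩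
    b + l * 2   ∎
  upper : b + l * 2 + 2 ≤ i + 2 ^ suc (suc j)
  upper = s≤s⁻¹ (begin
    suc (b + l * 2 + 2)      ≤⟨ s≤s (+-monoˡ-≤ 2 (+-monoˡ-≤ (l * 2) (s≤s⁻¹ b<2))) ⟩
    suc (1 + l * 2 + 2)      ≡⟨ e₁ l ⟩
    (l + 2) * 2              ≤⟨ *-monoˡ-≤ 2 l≤ ⟩
    (i′ + 2 ^ suc j) * 2     ≡⟨ e₂ i′ (2 ^ suc j) ⟩
    i′ * 2 + 2 * 2 ^ suc j   ≤⟨ +-monoˡ-≤ (2 * 2 ^ suc j) (begin
      i′ * 2                   ≤⟨ m≤n+m (i′ * 2) (suc i % 2) ⟩
      suc i % 2 + i′ * 2       ≡⟨ m≡m%n+[m/n]*n (suc i) 2 ⟨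
      suc i                    ∎) ⟩
    suc i + 2 ^ suc (suc j)  ∎)
    where
    e₁ : ∀ l → suc (1 + l * 2 + 2) ≡ (l + 2) * 2
    e₁ = solve-∀
    e₂ : ∀ x y → (x + y) * 2 ≡ x * 2 + 2 * y
    e₂ = solve-∀

-- `choice-separates` needs a window of `2 ^ suc e - 1` layers. This `e` makes the window fit into
-- `x` layers and loses only a constant factor.
log₂-bounds : ∀ x → 0 < x → ∃[ e ] (2 ^ suc e ≤ suc x × x ≤ 4 * 2 ^ e)
log₂-bounds (suc zero)    _ = 0 , ≤-refl , s≤s z≤n
log₂-bounds (suc (suc x)) _ with e , lower , upper ← log₂-bounds (suc x) (s≤s z≤n) with 2 ^ suc (suc e) ≤? 3 + x
... | yes le = suc e , le , (begin
  2 + x            ≤⟨ s≤s upper ⟩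
  1 + 4 * 2 ^ e    ≤⟨ +-monoˡ-≤ (4 * 2 ^ e) (≤-trans (m^n>0 2 e) (m≤m+n (2 ^ e) _)) ⟩
  4 * 2 ^ e + 4 * 2 ^ e  ≡⟨ eight (2 ^ e) ⟩
  4 * 2 ^ suc e    ∎)
  where
  open ≤-Reasoning
  eight : ∀ y → 4 * y + 4 * y ≡ 4 * (2 * y)
  eight = solve-∀
... | no ≰ = e , ≤-trans lower (n≤1+n (2 + x)) , (begin
  2 + x            ≤⟨ n≤1+n (2 + x) ⟩
  3 + x            ≤⟨ <⇒≤ (≰⇒> ≰) ⟩
  2 ^ suc (suc e)  ≡⟨ *-assoc 2 2 (2 ^ e) ⟨
  4 * 2 ^ e        ∎)
  where open ≤-Reasoning

-- The layered graph

energy : ℕ → ℕ → ℕ → ℕ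
energy L s a = 2 * s * a + L * a * a

-- The increment of 2sa + La² from a - 1 to a is 2s + L(2a - 1), to be compared with the slope 2t + 1 + L.
energy-optimal : ∀ {L s t c a} → t < L * c + s → L * c + s ≤ t + L → a ≢ c →
  energy L s c + (2 * t + 1 + L) * a < energy L s a + (2 * t + 1 + L) * c
energy-optimal {L} {s} {t} {c} {a} above below a≢c with ≤-total c a
... | inj₁ c≤a with m≤n⇒∃[o]m+o≡n c≤a
...   | zero , eq = ⊥-elim (a≢c (trans (sym eq) (+-identityʳ c)))
...   | d@(suc e) , refl = begin-strict
  -- The added `d` is the slack left by the odd summand of the slope: it turns `2 * t + 1` into
  -- `2 * suc t`, to which `above` applies.
  energy L s c + (2 * t + 1 + L) * (c + d)                            <⟨ m<m+n _ (s≤s z≤n) ⟩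
  energy L s c + (2 * t + 1 + L) * (c + d) + d                        ≡⟨ e₁ L s t c d ⟩
  energy L s c + (2 * t + 1 + L) * c + d * (2 * suc t + L)            ≤⟨ +-monoʳ-≤ (energy L s c + (2 * t + 1 + L) * c) (*-monoʳ-≤ d (+-mono-≤ (*-monoʳ-≤ 2 above) (m≤m*n L d))) ⟩
  energy L s c + (2 * t + 1 + L) * c + d * (2 * (L * c + s) + L * d)  ≡⟨ e₂ L s t c d ⟩
  energy L s (c + d) + (2 * t + 1 + L) * c                            ∎
  where
  open ≤-Reasoning
  e₁ : ∀ L s t c d → 2 * s * c + L * c * c + (2 * t + 1 + L) * (c + d) + d ≡
    2 * s * c + L * c * c + (2 * t + 1 + L) * c + d * (2 * (1 + t) + L)
  e₁ = solve-∀
  e₂ : ∀ L s t c d → 2 * s * c + L * c * c + (2 * t + 1 + L) * c + d * (2 * (L * c + s) + L * d) ≡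
    2 * s * (c + d) + L * (c + d) * (c + d) + (2 * t + 1 + L) * c
  e₂ = solve-∀
energy-optimal {L} {s} {t} {c} {a} above below a≢c | inj₂ a≤c with m≤n⇒∃[o]m+o≡n a≤c
... | zero , eq = ⊥-elim (a≢c (trans (sym (+-identityʳ a)) eq))
... | d@(suc e) , refl = begin-strict
  energy L s (a + d) + (2 * t + 1 + L) * a                                      <⟨ m<m+n _ (s≤s z≤n) ⟩
  energy L s (a + d) + (2 * t + 1 + L) * a + d                                  ≡⟨ e₁ L s t a d ⟩
  energy L s a + (2 * t + 1 + L) * a + d * (2 * s + 2 * L * a + L * d + 1)      ≤⟨ +-monoʳ-≤ (energy L s a + (2 * t + 1 + L) * a) (*-monoʳ-≤ d (+-monoˡ-≤ 1 slope)) ⟩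
  energy L s a + (2 * t + 1 + L) * a + d * (2 * t + L + 1)                      ≡⟨ e₂ L s t a d ⟩
  energy L s a + (2 * t + 1 + L) * (a + d)                                      ∎
  where
  open ≤-Reasoning
  e₁ : ∀ L s t a d → 2 * s * (a + d) + L * (a + d) * (a + d) + (2 * t + 1 + L) * a + d ≡
    2 * s * a + L * a * a + (2 * t + 1 + L) * a + d * (2 * s + 2 * L * a + L * d + 1)
  e₁ = solve-∀
  e₂ : ∀ L s t a d → 2 * s * a + L * a * a + (2 * t + 1 + L) * a + d * (2 * t + L + 1) ≡
    2 * s * a + L * a * a + (2 * t + 1 + L) * (a + d)
  e₂ = solve-∀
  e₃ : ∀ L s a d → 2 * s + 2 * L * a + L * d + L * d ≡ 2 * (L * (a + d) + s)
  e₃ = solve-∀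
  e₄ : ∀ L t → 2 * (t + L) ≡ 2 * t + L + L
  e₄ = solve-∀
  slope : 2 * s + 2 * L * a + L * d ≤ 2 * t + L
  slope = +-cancelʳ-≤ L _ _ (begin
    2 * s + 2 * L * a + L * d + L      ≤⟨ +-monoʳ-≤ (2 * s + 2 * L * a + L * d) (m≤m*n L d) ⟩
    2 * s + 2 * L * a + L * d + L * d  ≡⟨ e₃ L s a d ⟩
    2 * (L * (a + d) + s)              ≤⟨ *-monoʳ-≤ 2 below ⟩
    2 * (t + L)                        ≡⟨ e₄ L t ⟩
    2 * t + L + L                      ∎)

digits-unique : ∀ B .{{_ : NonZero B}} {x y x′ y′} → y < B → y′ < B → y + x * B ≡ y′ + x′ * B → y ≡ y′ × x ≡ x′
digits-unique B {x} {y} {x′} {y′} y<B y′<B eq = y≡y′ ,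
  *-cancelʳ-≡ x x′ B (+-cancelˡ-≡ y (x * B) (x′ * B) (trans eq (cong (_+ x′ * B) (sym y≡y′))))
  where
  remainder : ∀ x {y} → y < B → (y + x * B) % B ≡ y
  remainder x {y} y<B = trans ([m+kn]%n≡m%n y x B) (m<n⇒m%n≡m y<B)
  y≡y′ : y ≡ y′
  y≡y′ = trans (sym (remainder x y<B)) (trans (cong (_% B) eq) (remainder x′ y′<B))

module Geometry (K κ : ℕ) where

  -- `W` bounds the energy of one edge, as offsets are at most `L` and `a ≤ K`. The energies of `L`
  -- edges therefore add up to less than `B`, so they never carry in base `B`.
  L W B : ℕ
  L = 2 ^ κ
  W = 2 * L * K + L * K * K
  B = suc (L * W)

  layerEnergy increment : ℕ → ℕ → ℕ
  layerEnergy l a = energy L (offset κ l) a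
  increment l a = layerEnergy l a + a * B

  -- A displacement with first coordinate x and second coordinate y < B is stored as y + x * B.
  ∑choice ∑energy displacement : ℕ → ℕ → ℕ
  ∑choice t l = ∑ l (λ i → choice κ i t)
  ∑energy t l = ∑ l (λ i → layerEnergy i (choice κ i t))
  displacement t l = ∑ l (λ i → increment i (choice κ i t))

  displacement-split : ∀ t l → displacement t l ≡ ∑energy t l + ∑choice t l * B
  displacement-split t l = trans (∑-+ l _ _) (cong (∑energy t l +_) (∑-*ʳ l (λ i → choice κ i t) B))

  layerEnergy≤ : ∀ l {a} → a ≤ K → layerEnergy l a ≤ W
  layerEnergy≤ l a≤K = +-mono-≤ (*-mono-≤ (*-monoʳ-≤ 2 (offset≤ κ l)) a≤K) (*-mono-≤ (*-monoʳ-≤ L a≤K) a≤K)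

  choice≤ : ∀ {t} l → t < K * L → choice κ l t ≤ K
  choice≤ {t} l t<KL = s≤s⁻¹ (*-cancelˡ-< L _ _ (begin-strict
    L * choice κ l t               ≤⟨ m≤m+n _ (offset κ l) ⟩
    L * choice κ l t + offset κ l  ≤⟨ choice-below κ l t ⟩
    t + L                          <⟨ +-monoˡ-< L t<KL ⟩
    K * L + L                      ≡⟨ rearrange K L ⟩
    L * suc K                      ∎))
    where
    open ≤-Reasoning
    rearrange : ∀ K L → K * L + L ≡ L * (1 + K)
    rearrange = solve-∀

  ∑energy< : ∀ {t} → t < K * L → ∑energy t L < B
  ∑energy< t<KL = s≤s (≤-trans (∑-mono L (λ i _ → layerEnergy≤ i (choice≤ i t<KL))) (≤-reflexive (∑-const L W)))

  increment-mono : ∀ l {a a′} → a ≤ a′ → increment l a ≤ increment l a′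
  increment-mono l a≤a′ = +-mono-≤ (+-mono-≤ (*-monoʳ-≤ (2 * offset κ l) a≤a′) (*-mono-≤ (*-monoʳ-≤ L a≤a′) a≤a′)) (*-monoˡ-≤ B a≤a′)

  increment-cancel : ∀ l {a a′} → increment l a′ ≤ increment l a → a′ ≤ a
  increment-cancel l {a} {a′} le = ≮⇒≥ λ a<a′ → <-irrefl refl (begin-strict
    layerEnergy l a + a * B    <⟨ +-monoʳ-< (layerEnergy l a) (*-monoˡ-< B a<a′) ⟩
    layerEnergy l a + a′ * B   ≤⟨ +-monoˡ-≤ (a′ * B) (+-mono-≤ (*-monoʳ-≤ (2 * offset κ l) (<⇒≤ a<a′)) (*-mono-≤ (*-monoʳ-≤ L (<⇒≤ a<a′)) (<⇒≤ a<a′))) ⟩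
    layerEnergy l a′ + a′ * B  ≤⟨ le ⟩
    layerEnergy l a + a * B    ∎)
    where open ≤-Reasoning

  displacement≤ : ∀ {t l} → t < K * L → l ≤ L → displacement t l ≤ L * W + B * (L * K)
  displacement≤ {t} {l} t<KL l≤L = begin
    displacement t l       ≤⟨ ∑-mono l (λ i _ → +-mono-≤ (layerEnergy≤ i (choice≤ i t<KL)) (*-monoˡ-≤ B (choice≤ i t<KL))) ⟩
    ∑ l (λ _ → W + K * B)  ≡⟨ ∑-const l (W + K * B) ⟩
    l * (W + K * B)        ≤⟨ *-monoˡ-≤ (W + K * B) l≤L ⟩
    L * (W + K * B)        ≡⟨ rearrange L W K B ⟩
    L * W + B * (L * K)    ∎
    where
    open ≤-Reasoning
    rearrange : ∀ L W K B → L * (W + K * B) ≡ L * W + B * (L * K)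
    rearrange = solve-∀

  slope : ℕ → ℕ
  slope t = 2 * t + 1 + L

  -- The displacement (X, Y) from layer i to layer j exceeds the minimum of the functional
  -- y - slope t * x by at least δ; the subtractions are moved across the inequality.
  record Move (t δ i p j q : ℕ) : Set where
    field
      X Y     : ℕ
      layers  : i ≤ j
      moved   : q ≡ p + (Y + X * B)
      bounded : Y + i * W ≤ j * W
      excess  : δ + (∑energy t j + slope t * (X + ∑choice t i)) ≤ ∑energy t i + Y + slope t * ∑choice t j
      -- The equality case: the minimum is attained only by the displacement of the critical path,
      -- which `excess` does not record.
      tight   : δ ≡ 0 → q + displacement t i ≡ p + displacement t j

  open Move

  Move-refl : ∀ {t i p} → Move t 0 i p i p
  Move-refl {t} {i} {p} = record
    { X = 0 ; Y = 0 ; layers = ≤-refl ; moved = sym (+-identityʳ p) ; bounded = ≤-refl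
    ; excess = ≤-reflexive (cong (_+ slope t * ∑choice t i) (sym (+-identityʳ (∑energy t i)))) ; tight = λ _ → refl }

  -- Excesses are added, and a sum of naturals vanishes only if both do; this is how `tight` is
  -- inherited.
  Move-trans : ∀ {t δ δ′ i p j q k r} → Move t δ i p j q → Move t δ′ j q k r → Move t (δ + δ′) i p k r
  Move-trans {t} {δ} {δ′} {i} {p} {j} {q} {k} {r} M N = record
    { X       = X M + X N
    ; Y       = Y M + Y N
    ; layers  = ≤-trans (layers M) (layers N)
    ; moved   = trans (moved N) (trans (cong (_+ (Y N + X N * B)) (moved M)) (e₁ p (Y M) (X M) (Y N) (X N) B))
    ; bounded = begin
        Y M + Y N + i * W    ≡⟨ e₂ (Y M) (Y N) (i * W) ⟩
        Y N + (Y M + i * W)  ≤⟨ +-monoʳ-≤ (Y N) (bounded M) ⟩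
        Y N + j * W          ≤⟨ bounded N ⟩
        k * W                ∎
    ; excess  = +-cancelʳ-≤ (∑energy t j + slope t * ∑choice t j) _ _ (begin
        δ + δ′ + (∑energy t k + slope t * (X M + X N + ∑choice t i)) + (∑energy t j + slope t * ∑choice t j)
          ≡⟨ e₃ δ δ′ (∑energy t k) (∑energy t j) (slope t) (X M) (X N) (∑choice t i) (∑choice t j) ⟩
        δ + (∑energy t j + slope t * (X M + ∑choice t i)) + (δ′ + (∑energy t k + slope t * (X N + ∑choice t j)))
          ≤⟨ +-mono-≤ (excess M) (excess N) ⟩
        ∑energy t i + Y M + slope t * ∑choice t j + (∑energy t j + Y N + slope t * ∑choice t k)
          ≡⟨ e₄ (∑energy t i) (∑energy t j) (Y M) (Y N) (slope t * ∑choice t j) (slope t * ∑choice t k) ⟩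
        ∑energy t i + (Y M + Y N) + slope t * ∑choice t k + (∑energy t j + slope t * ∑choice t j) ∎)
    ; tight   = λ δ+δ′≡0 → +-cancelʳ-≡ (q + displacement t j) _ _
        (trans (e₅ r (displacement t i) q (displacement t j))
        (trans (cong₂ _+_ (tight N (m+n≡0⇒n≡0 δ δ+δ′≡0)) (tight M (m+n≡0⇒m≡0 δ δ+δ′≡0)))
          (e₆ q (displacement t k) p (displacement t j))))
    }
    where
    open ≤-Reasoning
    e₁ : ∀ p y x y′ x′ B → p + (y + x * B) + (y′ + x′ * B) ≡ p + (y + y′ + (x + x′) * B)
    e₁ = solve-∀
    e₂ : ∀ y y′ w → y + y′ + w ≡ y′ + (y + w)
    e₂ = solve-∀
    e₃ : ∀ d d′ Ek Ej λt x x′ Ci Cj → d + d′ + (Ek + λt * (x + x′ + Ci)) + (Ej + λt * Cj) ≡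
      d + (Ej + λt * (x + Ci)) + (d′ + (Ek + λt * (x′ + Cj)))
    e₃ = solve-∀
    e₄ : ∀ Ei Ej y y′ u v → Ei + y + u + (Ej + y′ + v) ≡ Ei + (y + y′) + v + (Ej + u)
    e₄ = solve-∀
    e₅ : ∀ r fi q fj → r + fi + (q + fj) ≡ (r + fj) + (q + fi)
    e₅ = solve-∀
    e₆ : ∀ q fk p fj → q + fk + (p + fj) ≡ p + fk + (q + fj)
    e₆ = solve-∀

  -- The minimiser of the layer has excess 0. Any other `a` has excess at least 1, because
  -- `energy-optimal` is strict and compares integers.
  increment-Move : ∀ t i p {a} → a ≤ K → ∃[ δ ] Move t δ i p (suc i) (p + increment i a)
  increment-Move t i p {a} a≤K with a ≟ choice κ i t
  ... | yes refl = 0 , record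
    { X = a ; Y = layerEnergy i a ; layers = n≤1+n i ; moved = refl ; bounded = +-monoˡ-≤ (i * W) (layerEnergy≤ i a≤K)
    ; excess = ≤-reflexive (cong (λ x → ∑energy t i + layerEnergy i a + slope t * x) (+-comm a (∑choice t i)))
    ; tight = λ _ → trans (+-assoc p _ _) (cong (p +_) (+-comm (increment i a) (displacement t i))) }
  ... | no a≢c = 1 , record
    { X = a ; Y = layerEnergy i a ; layers = n≤1+n i ; moved = refl ; bounded = +-monoˡ-≤ (i * W) (layerEnergy≤ i a≤K)
    ; excess = begin
        1 + (∑energy t i + layerEnergy i c + slope t * (a + ∑choice t i))
          ≡⟨ e₁ (∑energy t i) (layerEnergy i c) (slope t) a (∑choice t i) ⟩
        ∑energy t i + slope t * ∑choice t i + suc (layerEnergy i c + slope t * a)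
          ≤⟨ +-monoʳ-≤ (∑energy t i + slope t * ∑choice t i)
               (energy-optimal {L} {offset κ i} (choice-above κ i t) (choice-below κ i t) a≢c) ⟩
        ∑energy t i + slope t * ∑choice t i + (layerEnergy i a + slope t * c)
          ≡⟨ e₂ (∑energy t i) (layerEnergy i a) (slope t) c (∑choice t i) ⟩
        ∑energy t i + layerEnergy i a + slope t * (∑choice t i + c) ∎
    ; tight = λ () }
    where
    open ≤-Reasoning
    c : ℕ
    c = choice κ i t
    e₁ : ∀ E e λt a C → 1 + (E + e + λt * (a + C)) ≡ E + λt * C + (1 + (e + λt * a))
    e₁ = solve-∀
    e₂ : ∀ E e λt c C → E + λt * C + (e + λt * c) ≡ E + e + λt * (C + c)
    e₂ = solve-∀

  -- `bounded` keeps `Y` below `B`, so after cancelling `p` the base `B` digits identify `X` and `Y`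
  -- with the critical totals. These attain the minimum, which leaves no room for `δ`.
  Move-critical : ∀ {t δ p} → t < K * L → Move t δ 0 p L (p + displacement t L) → δ ≡ 0
  Move-critical {t} {δ} {p} t<KL M
    with Y≡E , X≡C ← digits-unique B {X M} {Y M} {∑choice t L} {∑energy t L}
           (s≤s (≤-trans (≤-reflexive (sym (+-identityʳ _))) (bounded M))) (∑energy< t<KL)
           (+-cancelˡ-≡ p _ _ (trans (sym (moved M)) (cong (p +_) (displacement-split t L))))
    = n≤0⇒n≡0 (+-cancelʳ-≤ (∑energy t L + slope t * ∑choice t L) _ _ (begin
      δ + (∑energy t L + slope t * ∑choice t L)  ≡⟨ cong (λ x → δ + (∑energy t L + slope t * x)) (trans (sym X≡C) (sym (+-identityʳ (X M)))) ⟩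
      δ + (∑energy t L + slope t * (X M + 0))    ≤⟨ excess M ⟩
      Y M + slope t * ∑choice t L                ≡⟨ cong (_+ slope t * ∑choice t L) Y≡E ⟩
      ∑energy t L + slope t * ∑choice t L        ∎))
    where open ≤-Reasoning

  -- Geometrically, a translate of the critical path in direction `t` passes through `p` in layer
  -- `i` and `q` in layer `j`.
  Aligned : ℕ → ℕ → ℕ → ℕ → ℕ → Set
  Aligned i p j q t = q + displacement t i ≡ p + displacement t j

  Aligned? : ∀ i p j q t → Dec (Aligned i p j q t)
  Aligned? i p j q t = q + displacement t i ≟ p + displacement t j

  -- Both directions have the same displacement from layer `i` to layer `j`, and increments are
  -- monotone in the direction, so they agree in each layer between. Directions `2 ^ d` or more
  -- apart would differ in some layer of the window that `long` provides.
  Aligned-close : ∀ {i p j q t t′} e d → e + d ≡ κ → i + 2 ^ suc e ≤ suc j → t ≤ t′ →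
    Aligned i p j q t → Aligned i p j q t′ → t′ < t + 2 ^ d
  Aligned-close {i} {p} {j} {q} {t} {t′} e d e+d≡κ long t≤t′ al al′ = ≰⇒> λ t+2^d≤t′ →
    let l , i≤l , l+2≤ , separated = choice-separates e d i t
        l<j = s≤s⁻¹ (≤-trans (≤-reflexive (+-comm 2 l)) (≤-trans l+2≤ long))
        equal = increment-cancel l (∑-pointwise (λ i → increment-mono i (choice-mono κ i t≤t′)) i≤l l<j same-total)
    in <-irrefl refl (<-≤-trans (subst (λ k → choice k l t < choice k l (t + 2 ^ d)) e+d≡κ separated)
         (≤-trans (choice-mono κ l t+2^d≤t′) equal))
    where
    e₁ : ∀ a b p q → a + b + (p + q) ≡ (p + a) + (q + b)
    e₁ = solve-∀
    e₂ : ∀ a b p q → (q + a) + (p + b) ≡ b + a + (p + q)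
    e₂ = solve-∀
    same-total : displacement t′ j + displacement t i ≤ displacement t j + displacement t′ i
    same-total = ≤-reflexive (+-cancelʳ-≡ (p + q) _ _
      (trans (e₁ (displacement t′ j) (displacement t i) p q)
      (trans (cong₂ _+_ (sym al′) al) (e₂ (displacement t′ i) (displacement t j) p q))))

  L>0 : 0 < L
  L>0 = m^n>0 2 κ

  scale : ∀ x → 0 < x → x ≤ L → ∃[ e ] ∃[ d ] (e + d ≡ κ × 2 ^ suc e ≤ suc x × x ≤ 4 * 2 ^ e)
  scale x x>0 x≤L with e , lower , upper ← log₂-bounds x x>0 =
    e , κ ∸ e , m+[n∸m]≡n {e} (≮⇒≥ λ κ<e → <-irrefl refl (begin-strict
      suc x              ≤⟨ s≤s x≤L ⟩
      1 + L              ≤⟨ +-monoˡ-≤ L L>0 ⟩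
      L + L              <⟨ m<m+n (L + L) (+-mono-<-≤ L>0 z≤n) ⟩
      L + L + (L + L)    ≡⟨ four L ⟩
      2 * (2 * L)        ≤⟨ *-monoʳ-≤ 2 (^-monoʳ-≤ 2 κ<e) ⟩
      2 ^ suc e          ≤⟨ lower ⟩
      suc x              ∎)) , lower , upper
    where
    open ≤-Reasoning
    four : ∀ L → L + L + (L + L) ≡ 2 * (2 * L)
    four = solve-∀

  -- At most `2 ^ d` directions are aligned, while `j - i` is at most `4 * 2 ^ e`, and `e + d` is
  -- `κ`: a longer span leaves proportionally fewer directions.
  ∑-Aligned : ∀ n i p {j} q → j ≤ L → ∑ n (λ t → 𝟙 (Aligned? i p j q t)) * (j ∸ i) ≤ 4 * L
  ∑-Aligned n i p {j} q j≤L with j ≤? i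
  ... | yes j≤i = ≤-trans (≤-reflexive (trans (cong (∑ n (λ t → 𝟙 (Aligned? i p j q t)) *_) (m≤n⇒m∸n≡0 j≤i)) (*-zeroʳ (∑ n (λ t → 𝟙 (Aligned? i p j q t)))))) z≤n
  ... | no j≰i
    with e , d , e+d≡κ , lower , upper ← scale (j ∸ i) (m<n⇒0<n∸m (≰⇒> j≰i)) (≤-trans (m∸n≤m j i) j≤L) = begin
    ∑ n (λ t → 𝟙 (Aligned? i p j q t)) * (j ∸ i)
      ≤⟨ *-mono-≤ (∑-𝟙-window (Aligned? i p j q) n λ t t′ → Aligned-close {i} {p} {j} {q} e d e+d≡κ long) upper ⟩
    2 ^ d * (4 * 2 ^ e)    ≡⟨ rearrange (2 ^ d) (2 ^ e) ⟩
    4 * (2 ^ e * 2 ^ d)    ≡⟨ cong (4 *_) (^-distribˡ-+-* 2 e d) ⟨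
    4 * 2 ^ (e + d)        ≡⟨ cong (λ k → 4 * 2 ^ k) e+d≡κ ⟩
    4 * L                  ∎
    where
    open ≤-Reasoning
    rearrange : ∀ x y → x * (4 * y) ≡ 4 * (y * x)
    rearrange = solve-∀
    long : i + 2 ^ suc e ≤ suc j
    long = begin
      i + 2 ^ suc e      ≤⟨ +-monoʳ-≤ i lower ⟩
      i + suc (j ∸ i)    ≡⟨ +-suc i (j ∸ i) ⟩
      suc (i + (j ∸ i))  ≡⟨ cong suc (m+[n∸m]≡n (<⇒≤ (≰⇒> j≰i))) ⟩
      suc j              ∎

-- Walks

module _ {n : ℕ} {E : Graph n} where

  snoc : ∀ {u v w k} → Walk E u v k → (v , w) ∈ E → Walk E u w (suc k)
  snoc here       e′ = step e′ here
  snoc (step e W) e′ = step e (snoc W e′)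

  Walk-++ˡ : ∀ {H u v k} → Walk E u v k → Walk (E ++ H) u v k
  Walk-++ˡ here       = here
  Walk-++ˡ (step e W) = step (∈-++⁺ˡ e) (Walk-++ˡ W)

-- The counting argument is by contradiction; decidability turns it into an actual pair of distant
-- vertices.
Walk? : ∀ {n} (E : Graph n) u v k → Dec (Walk E u v k)
Walk? E u v zero    = map′ (λ { refl → here }) (λ { here → refl }) (u Fin.≟ v)
Walk? E u v (suc k) = map′ (λ any → let w , e , W = to any in step e W) (λ { (step e W) → from (_ , e , W) }) (Any.any? (λ (x , w) → (u Fin.≟ x) ×-dec Walk? E w v k) E)
  where
  to : ∀ {E′} → Any.Any (λ (x , w) → u ≡ x × Walk E w v k) E′ → ∃[ w ] ((u , w) ∈ E′ × Walk E w v k)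
  to (here (refl , W)) = _ , here refl , W
  to (there any)       = let w , e , W = to any in w , there e , W
  from : ∀ {E′} → ∃[ w ] ((u , w) ∈ E′ × Walk E w v k) → Any.Any (λ (x , w) → u ≡ x × Walk E w v k) E′
  from (w , e , W) = Any.map (λ { refl → refl , W }) e

-- The graph on `Fin n` and its critical paths

module Layered (K′ κ : ℕ) where

  K : ℕ
  K = suc K′

  open Geometry K κ
  open Move

  -- Critical paths start below `starts` and move by at most `L * W + starts`, where
  -- `L * W < B ≤ starts`. Thus they stay within `width`, and a third of the positions in layer 0
  -- are starts.
  starts width n : ℕ
  starts = B * (L * K)
  width  = 3 * starts
  n      = suc L * width

  layer pos : Fin n → ℕ
  layer u = toℕ (proj₁ (remQuot {suc L} width u))
  pos u   = toℕ (proj₂ (remQuot {suc L} width u))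

  layer≤ : ∀ u → layer u ≤ L
  layer≤ u = s≤s⁻¹ (Fin.toℕ<n (proj₁ (remQuot {suc L} width u)))

  vertex : ∀ {l p} → l ≤ L → p < width → ∃[ u ] (layer u ≡ l × pos u ≡ p)
  vertex {l} {p} l≤L p<width = combine l′ p′ ,
    trans (cong (toℕ ∘ proj₁) (Fin.remQuot-combine l′ p′)) (Fin.toℕ-fromℕ< (s≤s l≤L)) ,
    trans (cong (toℕ ∘ proj₂) (Fin.remQuot-combine l′ p′)) (Fin.toℕ-fromℕ< p<width)
    where
    l′ = fromℕ< (s≤s l≤L)
    p′ = fromℕ< p<width

  vertex-unique : ∀ {u v} → layer u ≡ layer v → pos u ≡ pos v → u ≡ v
  vertex-unique {u} {v} layers≡ pos≡ = trans (sym (Fin.combine-remQuot {suc L} width u))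
    (trans (cong₂ combine (Fin.toℕ-injective layers≡) (Fin.toℕ-injective pos≡)) (Fin.combine-remQuot {suc L} width v))

  Edge : Fin n → Fin n → Set
  Edge u v = layer v ≡ suc (layer u) × ∃[ a ] (a < suc K × pos v ≡ pos u + increment (layer u) a)

  Edge? : ∀ u v → Dec (Edge u v)
  Edge? u v = (layer v ≟ suc (layer u)) ×-dec anyUpTo? (λ a → pos v ≟ pos u + increment (layer u) a) (suc K)

  edges : Graph n
  edges = filter (uncurry Edge?) (cartesianProduct (allFin n) (allFin n))

  Edge⇒∈ : ∀ {u v} → Edge u v → (u , v) ∈ edges
  Edge⇒∈ {u} {v} e = ∈-filter⁺ (uncurry Edge?) (∈-cartesianProduct⁺ (∈-allFin u) (∈-allFin v)) e

  ∈⇒Edge : ∀ {u v} → (u , v) ∈ edges → Edge u v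
  ∈⇒Edge e = proj₂ (∈-filter⁻ (uncurry Edge?) {xs = cartesianProduct (allFin n) (allFin n)} e)

  starts>0 : 0 < starts
  starts>0 = *-mono-≤ {1} {B} {1} {L * K} (s≤s z≤n) (*-mono-≤ {1} {L} {1} {K} L>0 (s≤s z≤n))

  position-fits : ∀ {p t l} → p < starts → t < K * L → l ≤ L → p + displacement t l < width
  position-fits {p} {t} {l} p<starts t<KL l≤L = begin-strict
    p + displacement t l             <⟨ +-mono-<-≤ p<starts (displacement≤ t<KL l≤L) ⟩
    starts + (L * W + starts)        ≤⟨ +-monoʳ-≤ starts (+-monoˡ-≤ starts (≤-trans (n≤1+n (L * W)) B≤starts)) ⟩
    starts + (starts + starts)       ≡⟨ three starts ⟩
    width                            ∎
    where
    open ≤-Reasoning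
    three : ∀ x → x + (x + x) ≡ 3 * x
    three = solve-∀
    B≤starts : B ≤ starts
    B≤starts = ≤-trans (≤-reflexive (sym (*-identityʳ B))) (*-monoʳ-≤ B (*-mono-≤ {1} {L} {1} {K} L>0 (s≤s z≤n)))

  critical-walk : ∀ {p t} → p < starts → t < K * L → ∀ l {u v} → l ≤ L → layer u ≡ 0 → pos u ≡ p →
    layer v ≡ l → pos v ≡ p + displacement t l → Walk edges u v l
  critical-walk {p} p<starts t<KL zero {u} {v} l≤L u0 up vl vp = subst (λ v → Walk edges u v 0)
    (vertex-unique (trans u0 (sym vl)) (trans up (trans (sym (+-identityʳ p)) (sym vp)))) here
  critical-walk {p} {t} p<starts t<KL (suc l) {u} {v} l<L u0 up vl vp =
    let w , wl , wp = vertex (<⇒≤ l<L) (position-fits p<starts t<KL (<⇒≤ l<L)) in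
    snoc (critical-walk p<starts t<KL l (<⇒≤ l<L) u0 up wl wp) (Edge⇒∈
      (trans vl (cong suc (sym wl)) , choice κ l t , s≤s (choice≤ l t<KL) ,
       trans vp (trans (sym (+-assoc p (displacement t l) (increment l (choice κ l t))))
         (cong₂ _+_ (sym wp) (cong (λ i → increment i (choice κ l t)) (sym wl))))))

  VertexMove : ℕ → ℕ → Fin n → Fin n → Set
  VertexMove t δ u v = Move t δ (layer u) (pos u) (layer v) (pos v)

  Edge⇒Move : ∀ t {u v} → Edge u v → ∃[ δ ] VertexMove t δ u v
  Edge⇒Move t {u} (layer≡ , a , a<1+K , pos≡) = let δ , M = increment-Move t (layer u) (pos u) (s≤s⁻¹ a<1+K) in
    δ , subst₂ (Move t δ (layer u) (pos u)) (sym layer≡) (sym pos≡) M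

  Walk⇒Move : ∀ t {u v k} → Walk edges u v k → ∃[ δ ] VertexMove t δ u v
  Walk⇒Move t here       = 0 , Move-refl
  Walk⇒Move t (step e W) = _ , Move-trans (proj₂ (Edge⇒Move t (∈⇒Edge e))) (proj₂ (Walk⇒Move t W))

  OnPath : ℕ → ℕ → Fin n → Set
  OnPath p t u = pos u ≡ p + displacement t (layer u)

  tight-OnPath : ∀ {p t u v} → VertexMove t 0 u v → OnPath p t u → OnPath p t v
  tight-OnPath {p} {t} {u} {v} M on = +-cancelʳ-≡ (displacement t (layer u)) _ _
    (trans (tight M refl) (trans (cong (_+ displacement t (layer v)) on)
      (+-swapʳ p (displacement t (layer u)) (displacement t (layer v)))))

  Shortcut : Set
  Shortcut = Fin n × Fin n

  span : Shortcut → ℕ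
  span (u , v) = layer v ∸ layer u

  UsedAfter : ℕ → ℕ → ℕ → Shortcut → Set
  UsedAfter p t x (u , v) = x ≤ layer u × OnPath p t u × OnPath p t v

  UsedAfter? : ∀ p t x h → Dec (UsedAfter p t x h)
  UsedAfter? p t x (u , v) = (x ≤? layer u) ×-dec (pos u ≟ _) ×-dec (pos v ≟ _)

  -- The layers that `h` can still skip for a walk on the critical path that has reached layer `x`.
  -- Summed over all shortcuts, this is a potential that pays for the shortcuts taken.
  saving : ℕ → ℕ → ℕ → Shortcut → ℕ
  saving p t x h = 𝟙 (UsedAfter? p t x h) * span h

  saving-anti : ∀ p t {x y} → x ≤ y → ∀ h → saving p t y h ≤ saving p t x h
  saving-anti p t {x} {y} x≤y h = *-monoˡ-≤ (span h) (𝟙-mono (UsedAfter? p t y h) (UsedAfter? p t x h)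
    λ (y≤ , on) → ≤-trans x≤y y≤ , on)

  -- From layer `layer v` on, a shortcut of positive span starts too early to be counted, so its
  -- whole span is released.
  saving-gain : ∀ p t {u v} → layer u ≤ layer v → OnPath p t u → OnPath p t v →
    saving p t (layer v) (u , v) + span (u , v) ≤ saving p t (layer u) (u , v)
  saving-gain p t {u} {v} u≤v onu onv = ≤-trans
    (absorb (𝟙 (UsedAfter? p t (layer v) (u , v))) (span (u , v)) (Sum.map
      m≤n⇒m∸n≡0 (λ u<v → 𝟙-false (UsedAfter? p t (layer v) (u , v)) λ (v≤u , _) → <⇒≱ u<v v≤u)
      (≤-<-connex (layer v) (layer u))))
    (≤-reflexive (cong (_* span (u , v)) (sym (𝟙-true (UsedAfter? p t (layer u) (u , v)) (≤-refl , onu , onv)))))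
    where
    absorb : ∀ x s → s ≡ 0 ⊎ x ≡ 0 → x * s + s ≤ 1 * s
    absorb x s (inj₁ refl) = ≤-reflexive (trans (+-identityʳ (x * 0)) (*-zeroʳ x))
    absorb x s (inj₂ refl) = ≤-reflexive (sym (+-identityʳ s))

  -- Double counting of the savings

  module WithShortcuts {H : List Shortcut} (shortcut : IsShortcutSet edges H) where

    totalSaving : ℕ → ℕ → ℕ → ℕ
    totalSaving p t x = sum (map (saving p t x) H)

    -- The excess of a walk is known only at its end, so the bound is conditional on `δ ≡ 0`. As
    -- excesses add, the condition passes to each step and to the rest of the walk, and keeps the
    -- walk on the critical path.
    Progress : ℕ → ℕ → Fin n → Fin n → ℕ → Set
    Progress p t u v k = ∃[ δ ] (VertexMove t δ u v ×
      (δ ≡ 0 → OnPath p t u → layer v ≤ layer u + (k + totalSaving p t (layer u))))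

    Progress-step : ∀ p t {u w v k} → ∃[ δ ] VertexMove t δ u w →
      (layer u ≤ layer w → OnPath p t u → OnPath p t w →
        layer w + totalSaving p t (layer w) ≤ layer u + (1 + totalSaving p t (layer u))) →
      Progress p t w v k → Progress p t u v (suc k)
    Progress-step p t {u} {w} {v} {k} (δ , M) gain (δ′ , N , rest) = δ + δ′ , Move-trans M N , λ δ+δ′≡0 onu →
      let onw = tight-OnPath (subst (λ δ → VertexMove t δ u w) (m+n≡0⇒m≡0 δ δ+δ′≡0) M) onu in begin
      layer v                                           ≤⟨ rest (m+n≡0⇒n≡0 δ δ+δ′≡0) onw ⟩
      layer w + (k + totalSaving p t (layer w))         ≡⟨ e₁ (layer w) k _ ⟩
      k + (layer w + totalSaving p t (layer w))         ≤⟨ +-monoʳ-≤ k (gain (layers M) onu onw) ⟩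
      k + (layer u + (1 + totalSaving p t (layer u)))   ≡⟨ e₂ (layer u) k _ ⟩
      layer u + (suc k + totalSaving p t (layer u))     ∎
      where
      open ≤-Reasoning
      e₁ : ∀ l k s → l + (k + s) ≡ k + (l + s)
      e₁ = solve-∀
      e₂ : ∀ l k s → k + (l + (1 + s)) ≡ l + (1 + k + s)
      e₂ = solve-∀

    -- An edge advances by one layer; a shortcut advances by its span, which the drop of
    -- `totalSaving` covers. A shortcut is also a `Move`, since a walk in `edges` joins its ends.
    progress : ∀ p t {u v k} → Walk (edges ++ H) u v k → Progress p t u v k
    progress p t here = 0 , Move-refl , λ _ _ → m≤m+n _ _
    progress p t {u} {v} {suc k} (step {w = w} e W) = [ edge , shortcutEdge ]′ (∈-++⁻ edges e)
      where
      open ≤-Reasoning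
      edge : (u , w) ∈ edges → Progress p t u v (suc k)
      edge e∈E = Progress-step p t (Edge⇒Move t (∈⇒Edge e∈E)) (λ u≤w _ _ → begin
        layer w + totalSaving p t (layer w)        ≡⟨ cong (_+ totalSaving p t (layer w)) (proj₁ (∈⇒Edge e∈E)) ⟩
        suc (layer u) + totalSaving p t (layer w)  ≤⟨ +-monoʳ-≤ (suc (layer u)) (sum-map-mono (saving-anti p t u≤w) H) ⟩
        suc (layer u) + totalSaving p t (layer u)  ≡⟨ +-suc (layer u) _ ⟨
        layer u + (1 + totalSaving p t (layer u))  ∎) (progress p t W)
      shortcutEdge : (u , w) ∈ H → Progress p t u v (suc k)
      shortcutEdge e∈H = Progress-step p t (Walk⇒Move t (proj₂ (proj₂ (shortcut e∈H)))) (λ u≤w onu onw → begin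
        layer w + totalSaving p t (layer w)                        ≡⟨ cong (_+ totalSaving p t (layer w)) (m+[n∸m]≡n u≤w) ⟨
        layer u + (layer w ∸ layer u) + totalSaving p t (layer w)  ≡⟨ rearrange (layer u) (layer w ∸ layer u) _ ⟩
        layer u + (totalSaving p t (layer w) + (layer w ∸ layer u))
          ≤⟨ +-monoʳ-≤ (layer u) (m≤n⇒m≤1+n (sum-map-gain (saving-anti p t u≤w) e∈H (saving-gain p t u≤w onu onw))) ⟩
        layer u + (1 + totalSaving p t (layer u))                  ∎) (progress p t W)
        where
        rearrange : ∀ l d s → l + d + s ≡ l + (s + d)
        rearrange = solve-∀

    -- A shortcut on the critical path from p in direction t determines p from t.
    ∑-saving : ∀ h → ∑ (K * L) (λ t → ∑ starts (λ p → saving p t 0 h)) ≤ 4 * L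
    ∑-saving h@(u , v) = begin
      ∑ (K * L) (λ t → ∑ starts (λ p → saving p t 0 h))  ≤⟨ ∑-mono (K * L) (λ t _ → per-direction t) ⟩
      ∑ (K * L) (λ t → 𝟙 (aligned? t) * span h)           ≡⟨ ∑-*ʳ (K * L) (λ t → 𝟙 (aligned? t)) (span h) ⟩
      ∑ (K * L) (λ t → 𝟙 (aligned? t)) * span h           ≤⟨ ∑-Aligned (K * L) (layer u) (pos u) (pos v) (layer≤ v) ⟩
      4 * L                                               ∎
      where
      open ≤-Reasoning
      aligned? : ∀ t → Dec (Aligned (layer u) (pos u) (layer v) (pos v) t)
      aligned? = Aligned? (layer u) (pos u) (layer v) (pos v)
      count : ∀ t → ∑ starts (λ p → 𝟙 (UsedAfter? p t 0 h)) ≤ 𝟙 (aligned? t)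
      count t = ∑-𝟙-unique (λ p → UsedAfter? p t 0 h) (aligned? t)
        (λ p (_ , onu , onv) → trans (cong (_+ displacement t (layer u)) onv)
          (trans (+-swapʳ p (displacement t (layer v)) (displacement t (layer u)))
            (cong (_+ displacement t (layer v)) (sym onu))))
        (λ p p′ (_ , on , _) (_ , on′ , _) → +-cancelʳ-≡ (displacement t (layer u)) p p′ (trans (sym on) on′))
        starts
      per-direction : ∀ t → ∑ starts (λ p → saving p t 0 h) ≤ 𝟙 (aligned? t) * span h
      per-direction t = ≤-trans (≤-reflexive (∑-*ʳ starts (λ p → 𝟙 (UsedAfter? p t 0 h)) (span h))) (*-monoˡ-≤ (span h) (count t))

    -- Exchanging the sums charges each shortcut with its savings on all critical paths, at most
    -- `4 * L` by `∑-saving`.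
    total-saving≤ : ∑ (K * L) (λ t → ∑ starts (λ p → totalSaving p t 0)) ≤ length H * (4 * L)
    total-saving≤ = begin
      ∑ (K * L) (λ t → ∑ starts (λ p → totalSaving p t 0))
        ≤⟨ ∑-mono (K * L) (λ t _ → ≤-reflexive (∑-sum-map starts (λ p → saving p t 0) H)) ⟩
      ∑ (K * L) (λ t → sum (map (λ h → ∑ starts (λ p → saving p t 0 h)) H))
        ≡⟨ ∑-sum-map (K * L) (λ t h → ∑ starts (λ p → saving p t 0 h)) H ⟩
      sum (map (λ h → ∑ (K * L) (λ t → ∑ starts (λ p → saving p t 0 h))) H)
        ≤⟨ sum-map-≤-length ∑-saving H ⟩
      length H * (4 * L) ∎
      where open ≤-Reasoning

    Critical : ℕ → Fin n → Fin n → Set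
    Critical t u v = layer u ≡ 0 × pos u < starts × layer v ≡ L × pos v ≡ pos u + displacement t L

    Critical? : ∀ t u v → Dec (Critical t u v)
    Critical? t u v = (layer u ≟ 0) ×-dec (pos u <? starts) ×-dec (layer v ≟ L) ×-dec (pos v ≟ pos u + displacement t L)

    Short : ℕ → Fin n → Fin n → Set
    Short D u v = ∃[ k ] (k < D × Walk (edges ++ H) u v k)

    Short? : ∀ D u v → Dec (Short D u v)
    Short? D u v = anyUpTo? (Walk? (edges ++ H) u v) D

    -- The endpoints force excess 0 by `Move-critical`, so `progress` applies: fewer than `L / 2`
    -- steps cover `L` layers, and savings must supply at least half of them.
    short-saving : ∀ {D t u v} → 2 * D ≤ L → t < K * L → Critical t u v → Short D u v → L ≤ 2 * totalSaving (pos u) t 0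
    short-saving {D} {t} {u} {v} 2D≤L t<KL (u0 , _ , vL , vp) (k , k<D , W) =
      let δ , M , bound = progress (pos u) t W
          δ≡0 = Move-critical t<KL (subst₂ (λ i j → Move t δ i (pos u) j (pos u + displacement t L)) u0 vL
                  (subst (Move t δ (layer u) (pos u) (layer v)) vp M))
          onu = trans (sym (+-identityʳ (pos u))) (cong (λ i → pos u + displacement t i) (sym u0)) in
      +-cancelˡ-≤ L _ _ (begin
        L + L                                          ≡⟨ double L ⟩
        2 * L                                          ≤⟨ *-monoʳ-≤ 2 (subst₂ (λ i j → j ≤ i + (k + totalSaving (pos u) t i)) u0 vL (bound δ≡0 onu)) ⟩
        2 * (k + totalSaving (pos u) t 0)              ≡⟨ *-distribˡ-+ 2 k (totalSaving (pos u) t 0) ⟩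
        2 * k + 2 * totalSaving (pos u) t 0            ≤⟨ +-monoˡ-≤ (2 * totalSaving (pos u) t 0) (≤-trans (*-monoʳ-≤ 2 (<⇒≤ k<D)) 2D≤L) ⟩
        L + 2 * totalSaving (pos u) t 0                ∎)
      where
      open ≤-Reasoning
      double : ∀ x → x + x ≡ 2 * x
      double = solve-∀

    -- Each of the `K * L * starts` critical paths needs a saving of `L / 2`, and the total is at
    -- most `length H * (4 * L)`; hence the factor 8.
    all-short : ∀ {D} → 2 * D ≤ L → (∀ {t u v} → t < K * L → Critical t u v → Short D u v) →
      K * L * starts ≤ 8 * length H
    all-short {D} 2D≤L short = *-cancelʳ-≤ _ _ L (begin
      K * L * starts * L                                            ≡⟨ *-assoc (K * L) starts L ⟩
      K * L * (starts * L)                                          ≡⟨ ∑-const (K * L) (starts * L) ⟨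
      ∑ (K * L) (λ _ → starts * L)                                  ≤⟨ ∑-mono (K * L) (λ t t<KL → per-direction t t<KL) ⟩
      ∑ (K * L) (λ t → ∑ starts (λ p → totalSaving p t 0) * 2)      ≡⟨ ∑-*ʳ (K * L) (λ t → ∑ starts (λ p → totalSaving p t 0)) 2 ⟩
      ∑ (K * L) (λ t → ∑ starts (λ p → totalSaving p t 0)) * 2      ≤⟨ *-monoˡ-≤ 2 total-saving≤ ⟩
      length H * (4 * L) * 2                                        ≡⟨ rearrange (length H) L ⟩
      8 * length H * L                                              ∎)
      where
      open ≤-Reasoning
      instance
        L≢0 : NonZero L
        L≢0 = m^n≢0 2 κ
      rearrange : ∀ h L → h * (4 * L) * 2 ≡ 8 * h * L
      rearrange = solve-∀
      per-path : ∀ {t p} → t < K * L → p < starts → L ≤ 2 * totalSaving p t 0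
      per-path {t} {p} t<KL p<starts =
        let u , u0 , up = vertex z≤n (<-≤-trans p<starts (m≤m+n starts _))
            v , vL , vp = vertex {L} ≤-refl (position-fits p<starts t<KL ≤-refl)
            critical = u0 , subst (_< starts) (sym up) p<starts , vL , trans vp (cong (_+ displacement t L) (sym up))
        in subst (λ p → L ≤ 2 * totalSaving p t 0) up (short-saving {D} {t} {u} {v} 2D≤L t<KL critical (short t<KL critical))
      per-direction : ∀ t → t < K * L → starts * L ≤ ∑ starts (λ p → totalSaving p t 0) * 2
      per-direction t t<KL = begin
        starts * L                                  ≡⟨ ∑-const starts L ⟨
        ∑ starts (λ _ → L)                          ≤⟨ ∑-mono starts (λ p p<starts → ≤-trans (per-path t<KL p<starts) (≤-reflexive (*-comm 2 (totalSaving p t 0)))) ⟩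
        ∑ starts (λ p → totalSaving p t 0 * 2)      ≡⟨ ∑-*ʳ starts (λ p → totalSaving p t 0) 2 ⟩
        ∑ starts (λ p → totalSaving p t 0) * 2      ∎

    Remote : ℕ → ℕ → Set
    Remote D t = ∃[ u ] ∃[ v ] (Critical t u v × ¬ Short D u v)

    Remote? : ∀ D t → Dec (Remote D t)
    Remote? D t = Fin.any? λ u → Fin.any? λ v → Critical? t u v ×-dec ¬? (Short? D u v)

    remote-diameter : ∀ {D t} → t < K * L → Remote D t → DiameterAtLeast (edges ++ H) D
    remote-diameter t<KL (u , v , (u0 , up , vL , vp) , ¬short) =
      u , v , (L , Walk-++ˡ (critical-walk up t<KL L ≤-refl u0 refl vL vp)) ,
      λ k W → ≮⇒≥ λ k<D → ¬short (k , k<D , W)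

    diameter-bound : ∀ D → 2 * D ≤ L → 8 * length H < K * L * starts → DiameterAtLeast (edges ++ H) D
    diameter-bound D 2D≤L few =
      let t , t<KL , remote = decidable-stable (anyUpTo? (Remote? D) (K * L)) λ none →
            <⇒≱ few (all-short 2D≤L λ {t} {u} {v} t<KL critical →
              decidable-stable (Short? D u v) λ ¬short → none (t , t<KL , u , v , critical , ¬short))
      in remote-diameter t<KL remote


-- Choice of the parameters

n<2^n : ∀ n → n < 2 ^ n
n<2^n zero    = s≤s z≤n
n<2^n (suc n) = +-mono-≤ (m^n>0 2 n) (≤-trans (n<2^n n) (m≤m+n (2 ^ n) 0))

module Parameters (a b m : ℕ) (1≤b : 1 ≤ b) where

  -- The 48 is the 8 of `all-short` times the 6 of `n≤`; the successor in `K` makes the comparison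
  -- strict. The exponent `suc m` makes `L` equal to `2 * D`.
  open Layered (48 * a) (suc m)
  open Geometry K (suc m)
  open ≤-Reasoning

  D : ℕ
  D = 2 ^ m

  width>0 : 0 < width
  width>0 = ≤-trans starts>0 (m≤m+n starts (2 * starts))

  n>0 : 0 < n
  n>0 = *-mono-≤ {1} {suc L} {1} {width} (s≤s z≤n) width>0

  m≤n : m ≤ n
  m≤n = begin
    m              ≤⟨ <⇒≤ (n<2^n m) ⟩
    D              ≤⟨ m≤m+n D (D + 0) ⟩
    L              ≤⟨ n≤1+n L ⟩
    suc L          ≡⟨ *-identityʳ (suc L) ⟨
    suc L * 1      ≤⟨ *-monoʳ-≤ (suc L) width>0 ⟩
    n              ∎

  n≤ : n ≤ 6 * (L * starts)
  n≤ = begin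
    suc L * (3 * starts)    ≤⟨ *-monoˡ-≤ (3 * starts) (+-monoˡ-≤ L L>0) ⟩
    (L + L) * (3 * starts)  ≡⟨ rearrange L starts ⟩
    6 * (L * starts)        ∎
    where
    rearrange : ∀ L S → (L + L) * (3 * S) ≡ 6 * (L * S)
    rearrange = solve-∀

  few-shortcuts : ∀ h → h * b ≤ a * n → 8 * h < K * L * starts
  few-shortcuts h hb≤an = begin-strict
    8 * h                          ≡⟨ cong (8 *_) (*-identityʳ h) ⟨
    8 * (h * 1)                    ≤⟨ *-monoʳ-≤ 8 (*-monoʳ-≤ h 1≤b) ⟩
    8 * (h * b)                    ≤⟨ *-monoʳ-≤ 8 (≤-trans hb≤an (*-monoʳ-≤ a n≤)) ⟩
    8 * (a * (6 * (L * starts)))   <⟨ m<m+n _ (*-mono-≤ {1} {L} {1} {starts} L>0 starts>0) ⟩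
    8 * (a * (6 * (L * starts))) + L * starts  ≡⟨ rearrange a L starts ⟩
    K * L * starts                 ∎
    where
    rearrange : ∀ a L S → 8 * (a * (6 * (L * S))) + L * S ≡ (1 + 48 * a) * L * S
    rearrange = solve-∀

  -- For fixed `K`, `B` is quadratic in `L`, so `n`, which is of order `L * (B * (L * K))`, is of
  -- order `L ^ 4`. This is the source of the exponent 1/4.
  B≤ : B ≤ 4 * (L * K * (L * K))
  B≤ = begin
    1 + L * W                                ≤⟨ +-mono-≤ (*-mono-≤ {1} {L * K} {1} {L * K} LK>0 LK>0) (≤-trans (≤-reflexive (e₁ L K)) (+-monoˡ-≤ (L * K * (L * K)) (*-monoʳ-≤ 2 LLK≤))) ⟩
    L * K * (L * K) + (2 * (L * K * (L * K)) + L * K * (L * K))  ≡⟨ e₂ (L * K * (L * K)) ⟩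
    4 * (L * K * (L * K))                    ∎
    where
    LK>0 : 0 < L * K
    LK>0 = *-mono-≤ {1} {L} {1} {K} L>0 (s≤s z≤n)
    e₁ : ∀ L K → L * (2 * L * K + L * K * K) ≡ 2 * (L * K * L) + L * K * (L * K)
    e₁ = solve-∀
    e₂ : ∀ x → x + (2 * x + x) ≡ 4 * x
    e₂ = solve-∀
    LLK≤ : L * K * L ≤ L * K * (L * K)
    LLK≤ = *-monoʳ-≤ (L * K) (m≤m*n L K)

  n≤[10KD]^4 : 1 ^ 4 * n ≤ (10 * K * D) ^ 4
  n≤[10KD]^4 = begin
    1 ^ 4 * n                                              ≡⟨ *-identityˡ n ⟩
    n                                                      ≤⟨ n≤ ⟩
    6 * (L * (B * (L * K)))                                ≤⟨ *-monoʳ-≤ 6 (*-monoʳ-≤ L (*-monoˡ-≤ (L * K) B≤)) ⟩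
    6 * (L * (4 * (L * K * (L * K)) * (L * K)))            ≡⟨ e₁ K D ⟩
    -- Here 384 is `6 * 4 * 2 ^ 4`, from `L = 2 * D`. Raising it to `10 ^ 4`, and the cube of `K` to
    -- a fourth power, makes the bound a perfect fourth power.
    384 * (D * D * D * D * (K * K * K))                    ≤⟨ *-mono-≤ {384} {10000} (m≤m+n 384 9616) (*-monoʳ-≤ (D * D * D * D) (m≤m*n (K * K * K) K)) ⟩
    10000 * (D * D * D * D * (K * K * K * K))              ≡⟨ e₂ K D ⟩
    (10 * K * D) ^ 4                                       ∎
    where
    e₁ : ∀ K D → 6 * (2 * D * (4 * (2 * D * K * (2 * D * K)) * (2 * D * K))) ≡ 384 * (D * D * D * D * (K * K * K))
    e₁ = solve-∀
    e₂ : ∀ K D → 10000 * (D * D * D * D * (K * K * K * K)) ≡ (10 * K * D) * ((10 * K * D) * ((10 * K * D) * ((10 * K * D) * 1)))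
    e₂ = solve-∀

theorem1p1 : (a b : ℕ) → 1 ≤ a → 1 ≤ b →
    ∃[ p ] ∃[ q ] (1 ≤ p × 1 ≤ q ×
    ((m : ℕ) → ∃[ n ] (m ≤ n × 1 ≤ n × Σ[ G ∈ Graph n ] ((H : List (Fin n × Fin n)) →
    Unique H → IsShortcutSet G H → length H * b ≤ a * n →
    ∃[ D ] (DiameterAtLeast (G ++ H) D × p ^ 4 * n ≤ (q * D) ^ 4)))))
-- With `C = a / b`, the constant is `c = 1 / (10 * K)`. It is fixed before `m`, which only sets the
-- scale `D = 2 ^ m` and thereby makes `n` arbitrarily large.
theorem1p1 a b _ 1≤b = 1 , 10 * suc (48 * a) , ≤-refl , s≤s z≤n , λ m →
  let open Layered (48 * a) (suc m)
      open Parameters a b m 1≤b in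
  n , m≤n , n>0 , edges , λ H _ shortcut |H|≤ →
    D , WithShortcuts.diameter-bound shortcut D ≤-refl (few-shortcuts (length H) |H|≤) , n≤[10KD]^4
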